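{- Let $n\ge1$, let $M=(M_0,\ldots,M_n)$ be a model of $VO_n$, let $A\subseteq M$ be finite, and let $E\subseteq M_0$ be $\mathcal{L}_n^*$-definable with parameters from $A$. Then $E$ has a unique canonical decomposition, and its extremities lie in $\langle A\rangle\cup\{\pm\infty\}$.
   Context: Let $\mathcal{L}_n^*$ be the $(n+1)$-sorted language with sorts $R_0, \ldots, R_n$, binary relation symbols $<_1,\ldots,<_n$ with $<_i$ on sort $R_i$, a constant symbol $0$ of sort $R_0$, and function symbols $f_i: R_0 \to R_i$ and $g_i: R_i \to R_0$ for $i=1,\ldots,n$. $VO_n$ is the $\mathcal{L}_n^*$-theory axiomatized by: (1) each $<_i$ is a dense linear order without endpoints on $R_i$; (2) each $f_i$ is injective; (3) $g_i(x)=f_i^{ -1}(x)$ if $x \in f_i(R_0)$ and $g_i(x)=0$ otherwise; (4) $f_i(R_0)$ is $<_i$-dense and $<_i$-co-dense in $R_i$; (5) whenever $a_i <_i b_i$ in $R_i$ for all $i$, there is $x_0 \in R_0$ with $a_i <_i f_i(x_0) <_i b_i$ for all $i$. In a model $M=(M_0,\ldots,M_n)$, $M_i$ interprets sort $R_i$, and $\langle A\rangle$ is the $\mathcal{L}_n^*$-substructure generated by $A$. A multi-interval is a set $I=\bigcap_{i=1}^n f_i^{ -1}(I^i)\subseteq M_0$ with each $I^i$ a nonempty $<_i$-open interval in $M_i$; its extremities are the endpoints of all the $I^i$. For $E \subseteq M_0$ and $e\in E$, a multi-interval $I=\bigcap_{i=1}^n f_i^{ -1}(I^i)$ with $e \in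 I\subseteq E$ is the maximal multi-interval in $E$ containing $e$ if for every $m\in\{1,\ldots,n\}$, $I^m$ is the maximal $<_m$-interval such that $f_m(e)\in I^m$ and there exist intervals $J^{m+1},\ldots,J^n$ in $M_{m+1},\ldots,M_n$ with $f_j(e)\in J^j$ for $j>m$ and $\bigcap_{l=1}^m f_l^{ -1}(I^l)\cap\bigcap_{j=m+1}^n f_j^{ -1}(J^j)\subseteq E$. Given $E\subseteq M_0$, finite sets $B\subseteq\mathbb{N}$ and $E_0\subseteq E$, and multi-intervals $I_j$ ($j\in B$), the expression $\bigcup_{j\in B}I_j\cup E_0$ is a canonical decomposition of $E$ if: (1) $E=\bigcup_{j\in B}I_j\cup E_0$; (2) no $e\in E_0$ lies in a multi-interval contained in $E$; (3) for every $e\in E\setminus E_0$ there is $j\in B$ such that $I_j$ is the maximal multi-interval in $E$ containing $e$; (4) for every $j\in B$ there is $e\in E\setminus E_0$ such that $I_j$ is the maximal multi-interval in $E$ containing $e$. -}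

module Defs where

open import Level using (Level; _⊔_) renaming (suc to lsuc)
open import Data.Nat using (ℕ)
open import Data.Fin using (Fin; zero; suc; _<_)
open import Data.List using (List; []; _∷_)
open import Data.List.Membership.Propositional using (_∈_; _∉_)
open import Data.List.Relation.Unary.Any using (Any)
open import Data.List.Relation.Unary.All as All using (All)
open import Data.Product using (Σ; ∃; _×_; _,_)
open import Data.Sum using (_⊎_)
open import Data.Unit.Polymorphic using (⊤)
open import Data.Empty.Polymorphic using (⊥)
open import Relation.Nullary using (¬_)
open import Relation.Binary.PropositionalEquality using (_≡_; _≢_)
open import Relation.Binary.Structures using (IsStrictTotalOrder)
open import Function.Definitions using (Injective)

-- The language L*_n.  Sorts are  Fin (suc n):  zero is R_0 and
-- suc i (i : Fin n) is R_{i+1}.  So the index i : Fin n stands for the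
-- paper's index i+1 ∈ {1,…,n}.

Sort : ℕ → Set
Sort n = Fin (ℕ.suc n)

record Structure (n : ℕ) (ℓ : Level) : Set (lsuc ℓ) where
  field
    Car : Sort n → Set ℓ
    lt  : (i : Fin n) → Car (suc i) → Car (suc i) → Set ℓ
    zer : Car zero
    f   : (i : Fin n) → Car zero → Car (suc i)
    g   : (i : Fin n) → Car (suc i) → Car zero

Ctx : ℕ → Set
Ctx n = List (Sort n)

data Term {n : ℕ} (Γ : Ctx n) : Sort n → Set where
  var : ∀ {s} → s ∈ Γ → Term Γ s
  c0  : Term Γ zero
  tf  : (i : Fin n) → Term Γ zero → Term Γ (suc i)
  tg  : (i : Fin n) → Term Γ (suc i) → Term Γ zero

data Formula {n : ℕ} : Ctx n → Set where
  tt ff : ∀ {Γ} → Formula Γ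
  eq    : ∀ {Γ s} → Term Γ s → Term Γ s → Formula Γ
  less  : ∀ {Γ} (i : Fin n) → Term Γ (suc i) → Term Γ (suc i) → Formula Γ
  neg   : ∀ {Γ} → Formula Γ → Formula Γ
  and or imp : ∀ {Γ} → Formula Γ → Formula Γ → Formula Γ
  all ex : ∀ {Γ} (s : Sort n) → Formula (s ∷ Γ) → Formula Γ

data Ext {ℓ : Level} (X : Set ℓ) : Set ℓ where
  -∞  : Ext X
  fin : X → Ext X
  +∞  : Ext X

module _ {n : ℕ} {ℓ : Level} (M : Structure n ℓ) where
  open Structure M

  Env : Ctx n → Set ℓ
  Env Γ = All Car Γ

  evalT : ∀ {Γ s} → Term Γ s → Env Γ → Car s
  evalT (var v)  ρ = All.lookup ρ v
  evalT c0       ρ = zer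
  evalT (tf i t) ρ = f i (evalT t ρ)
  evalT (tg i t) ρ = g i (evalT t ρ)

  Sat : ∀ {Γ} → Formula Γ → Env Γ → Set ℓ
  Sat tt           ρ = ⊤
  Sat ff           ρ = ⊥
  Sat (eq t u)     ρ = evalT t ρ ≡ evalT u ρ
  Sat (less i t u) ρ = lt i (evalT t ρ) (evalT u ρ)
  Sat (neg φ)      ρ = ¬ Sat φ ρ
  Sat (and φ ψ)    ρ = Sat φ ρ × Sat ψ ρ
  Sat (or φ ψ)     ρ = Sat φ ρ ⊎ Sat ψ ρ
  Sat (imp φ ψ)    ρ = Sat φ ρ → Sat ψ ρ
  Sat (all s φ)    ρ = (x : Car s) → Sat φ (x All.∷ ρ)
  Sat (ex s φ)     ρ = Σ (Car s) λ x → Sat φ (x All.∷ ρ)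

  record IsVO : Set ℓ where
    field
      order    : (i : Fin n) → IsStrictTotalOrder _≡_ (lt i)
      dense    : (i : Fin n) (a b : Car (suc i)) → lt i a b →
                 Σ (Car (suc i)) λ c → lt i a c × lt i c b
      no-min   : (i : Fin n) (a : Car (suc i)) → Σ (Car (suc i)) λ c → lt i c a
      no-max   : (i : Fin n) (a : Car (suc i)) → Σ (Car (suc i)) λ c → lt i a c
      f-inj    : (i : Fin n) → Injective _≡_ _≡_ (f i)
      g-image  : (i : Fin n) (x : Car zero) (y : Car (suc i)) → f i x ≡ y → g i y ≡ x
      g-else   : (i : Fin n) (y : Car (suc i)) → ((x : Car zero) → f i x ≢ y) → g i y ≡ zer
      img-dense   : (i : Fin n) (a b : Car (suc i)) → lt i a b →
                    Σ (Car zero) λ x → lt i a (f i x) × lt i (f i x) b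
      img-codense : (i : Fin n) (a b : Car (suc i)) → lt i a b →
                    Σ (Car (suc i)) λ c → lt i a c × lt i c b × ((x : Car zero) → f i x ≢ c)
      simult   : (a b : (i : Fin n) → Car (suc i)) → ((i : Fin n) → lt i (a i) (b i)) →
                 Σ (Car zero) λ x → (i : Fin n) → lt i (a i) (f i x) × lt i (f i x) (b i)

  Params : Set ℓ
  Params = List (Σ (Sort n) Car)

  Definable : Params → (Car zero → Set ℓ) → Set ℓ
  Definable A E =
    Σ (Ctx n) λ Γ → Σ (Formula (zero ∷ Γ)) λ φ → Σ (Env Γ) λ ρ →
      ((s : Sort n) (v : s ∈ Γ) → (s , All.lookup ρ v) ∈ A) ×
      ((x : Car zero) → (E x → Sat φ (x All.∷ ρ)) × (Sat φ (x All.∷ ρ) → E x))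

  data Gen (A : Params) : (s : Sort n) → Car s → Set ℓ where
    base : ∀ {s a} → (s , a) ∈ A → Gen A s a
    gen0 : Gen A zero zer
    genf : ∀ (i : Fin n) {x} → Gen A zero x → Gen A (suc i) (f i x)
    geng : ∀ (i : Fin n) {y} → Gen A (suc i) y → Gen A zero (g i y)

  ltE : (i : Fin n) → Ext (Car (suc i)) → Ext (Car (suc i)) → Set ℓ
  ltE i -∞      -∞      = ⊥
  ltE i -∞      (fin _) = ⊤
  ltE i -∞      +∞      = ⊤
  ltE i (fin a) -∞      = ⊥
  ltE i (fin a) (fin b) = lt i a b
  ltE i (fin a) +∞      = ⊤
  ltE i +∞      _       = ⊥

  Interval : Fin n → Set ℓ
  Interval i = Ext (Car (suc i)) × Ext (Car (suc i))

  _∈I_ : ∀ {i} → Car (suc i) → Interval i → Set ℓ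
  _∈I_ {i} y (lo , hi) = ltE i lo (fin y) × ltE i (fin y) hi

  NonEmptyI : ∀ {i} → Interval i → Set ℓ
  NonEmptyI {i} J = Σ (Car (suc i)) λ y → y ∈I J

  _⊆I_ : ∀ {i} → Interval i → Interval i → Set ℓ
  _⊆I_ {i} J K = (y : Car (suc i)) → y ∈I J → y ∈I K

  -- a tuple of intervals (I^1,…,I^n); it determines the set ⋂ f_i⁻¹(I^i)
  Box : Set ℓ
  Box = (i : Fin n) → Interval i

  _∈B_ : Car zero → Box → Set ℓ
  x ∈B I = (i : Fin n) → f i x ∈I I i

  _⊆_ : Box → (Car zero → Set ℓ) → Set ℓ
  I ⊆ E = (x : Car zero) → x ∈B I → E x

  IsMultiInterval : Box → Set ℓ
  IsMultiInterval I = (i : Fin n) → NonEmptyI (I i)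

  _≐_ : Box → Box → Set ℓ
  I ≐ K = (i : Fin n) → I i ≡ K i

  -- condition on J (in the role of I^m) in the definition of maximality:
  -- f_m(e) ∈ J and there are intervals J^j (j > m) containing f_j(e) with
  -- ⋂_{l<m} f_l⁻¹(I^l) ∩ f_m⁻¹(J) ∩ ⋂_{j>m} f_j⁻¹(J^j) ⊆ E.
  Good : (Car zero → Set ℓ) → Car zero → Box → (m : Fin n) → Interval m → Set ℓ
  Good E e I m J =
    Σ Box λ K → ((l : Fin n) → l < m → K l ≡ I l) × K m ≡ J ×
      ((j : Fin n) → m < j → f j e ∈I K j) × f m e ∈I J × K ⊆ E

  MaxMI : (Car zero → Set ℓ) → Car zero → Box → Set ℓ
  MaxMI E e I =
    IsMultiInterval I × e ∈B I × I ⊆ E ×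
    ((m : Fin n) → Good E e I m (I m) ×
                   ((J : Interval m) → Good E e I m J → J ⊆I I m))

  -- a decomposition ⋃_{j∈B} I_j ∪ E_0 (B finite: a list of multi-intervals)
  Decomp : Set ℓ
  Decomp = List Box × List (Car zero)

  _∈MI_ : Box → List Box → Set ℓ
  I ∈MI Is = Any (λ K → K ≐ I) Is

  record Canonical (E : Car zero → Set ℓ) (D : Decomp) : Set ℓ where
    constructor canonical
    Is = Data.Product.proj₁ D
    E₀ = Data.Product.proj₂ D
    field
      multi  : All IsMultiInterval Is
      E₀⊆E   : All E E₀
      cover  : (x : Car zero) → (E x → Any (x ∈B_) Is ⊎ x ∈ E₀) ×
                                 (Any (x ∈B_) Is ⊎ x ∈ E₀ → E x)
      isol   : (e : Car zero) → e ∈ E₀ →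
               ¬ (Σ Box λ I → IsMultiInterval I × e ∈B I × I ⊆ E)
      maxes  : (e : Car zero) → E e → e ∉ E₀ → Any (MaxMI E e) Is
      needed : All (λ I → Σ (Car zero) λ e → E e × e ∉ E₀ × MaxMI E e I) Is

  SameDecomp : Decomp → Decomp → Set ℓ
  SameDecomp (Is , E₀) (Ks , F₀) =
    ((I : Box) → (I ∈MI Is → I ∈MI Ks) × (I ∈MI Ks → I ∈MI Is)) ×
    ((x : Car zero) → (x ∈ E₀ → x ∈ F₀) × (x ∈ F₀ → x ∈ E₀))

  ExtInGen : Params → (i : Fin n) → Ext (Car (suc i)) → Set ℓ
  ExtInGen A i -∞      = ⊤
  ExtInGen A i (fin y) = Gen A (suc i) y
  ExtInGen A i +∞      = ⊤

  ExtremitiesIn : Params → Decomp → Set ℓ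
  ExtremitiesIn A (Is , _) =
    All (λ I → (i : Fin n) → ExtInGen A i (Data.Product.proj₁ (I i)) ×
                               ExtInGen A i (Data.Product.proj₂ (I i))) Is

{-# OPTIONS --safe #-}

-- Finite partial isomorphisms closed under the f_i and g_i form a back-and-forth system: a new
-- x ∈ M_0 is matched using simultaneous density, a new y ∉ f_i(M_0) using co-density.  Hence
-- membership in E depends only on the cuts of f_i(x) over the finite set ⟨A⟩, so E is a finite union of
-- cells and points of ⟨A⟩.  Consequently a multi-interval contained in E stays in E when its
-- endpoints are moved outwards to ⟨A⟩ ∪ {±∞}: each new cell already meets it.  The maximal
-- multi-interval around e is therefore found among finitely many candidates, one coordinate at a
-- time, replacing I^m by its hull with every admissible J and intersecting in the coordinates
-- j > m.  Uniqueness holds because maximality determines I^m from the I^l with l < m.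

module Submission where

open import Defs
open import Level using (Level)
open import Data.Nat using (ℕ; _≤_; _<_; s≤s)
open import Data.Nat.Properties using (≤-refl; ≤-pred; <⇒≤; <-trans; m≤n⇒m<n∨m≡n)
open import Data.Fin using (Fin; zero; suc; toℕ; fromℕ<) renaming (_<_ to _<ᶠ_)
open import Data.Fin.Induction using (<-wellFounded)
open import Data.Fin.Properties using (<-cmp; toℕ<n; toℕ-fromℕ<; toℕ-injective) renaming (_≟_ to _≟ᶠ_)
open import Data.List using (List; []; _∷_; _++_; map; filter; allFin; cartesianProduct; cartesianProductWith)
open import Data.List.Membership.Propositional using (_∈_; _∉_; find; lose)
open import Data.List.Membership.Propositional.Properties
  using (∈-map⁺; ∈-map⁻; ∈-++⁺ˡ; ∈-++⁺ʳ; ∈-++⁻; ∈-allFin;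
    ∈-cartesianProduct⁺; ∈-cartesianProductWith⁺; ∈-filter⁺; ∈-filter⁻)
open import Data.List.Relation.Unary.Any as Any using (Any; here; there)
open import Data.List.Relation.Unary.All as All using (All)
open import Data.Product using (Σ; _×_; _,_; proj₁; proj₂)
open import Data.Sum using (_⊎_; inj₁; inj₂; [_,_])
open import Data.Empty using (⊥-elim)
open import Function using (_∘_; case_of_)
open import Relation.Nullary using (¬_; yes; no)
open import Relation.Binary.Core using (Rel)
open import Relation.Binary.Definitions using (Trichotomous; tri<; tri≈; tri>)
open import Relation.Binary.Structures using (IsStrictTotalOrder)
open import Relation.Binary.PropositionalEquality
  using (_≡_; _≢_; refl; sym; trans; cong; cong₂; subst; subst₂; isEquivalence; resp₂)
import Relation.Binary.Construct.Flip.EqAndOrd as Flip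
open import Induction.WellFounded using (Acc; acc)
open import Axiom.ExcludedMiddle using (ExcludedMiddle)

-- Linear orders and extrema over finite lists.

module LinearOrder {ℓ : Level} (em : ExcludedMiddle ℓ) {X : Set ℓ} {_<_ : Rel X ℓ}
  (isOrder : IsStrictTotalOrder _≡_ _<_) where

  private module O = IsStrictTotalOrder isOrder

  _≼_ : X → X → Set ℓ
  a ≼ b = ¬ (b < a)

  irrefl : ∀ a → ¬ (a < a)
  irrefl a = O.irrefl refl

  ≼-<-trans : ∀ a b c → a ≼ b → b < c → a < c
  ≼-<-trans a b c a≼b b<c with O.compare a b
  ... | tri< a<b _ _ = O.trans a<b b<c
  ... | tri≈ _ refl _ = b<c
  ... | tri> _ _ b<a = ⊥-elim (a≼b b<a)

  <-≼-trans : ∀ a b c → a < b → b ≼ c → a < c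
  <-≼-trans a b c a<b b≼c with O.compare b c
  ... | tri< b<c _ _ = O.trans a<b b<c
  ... | tri≈ _ refl _ = a<b
  ... | tri> _ _ c<b = ⊥-elim (b≼c c<b)

  ≼-antisym : ∀ a b → a ≼ b → b ≼ a → a ≡ b
  ≼-antisym a b a≼b b≼a with O.compare a b
  ... | tri< a<b _ _ = ⊥-elim (b≼a a<b)
  ... | tri≈ _ a≡b _ = a≡b
  ... | tri> _ _ b<a = ⊥-elim (a≼b b<a)

  ≺-or-≽ : ∀ a b → a < b ⊎ b ≼ a
  ≺-or-≽ a b with em {a < b}
  ... | yes a<b = inj₁ a<b
  ... | no a≮b = inj₂ a≮b

  maximum : ∀ a b → Σ X λ c → (c ≡ a ⊎ c ≡ b) × a ≼ c × b ≼ c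
  maximum a b with ≺-or-≽ a b
  ... | inj₁ a<b = b , inj₂ refl , O.asym a<b , irrefl b
  ... | inj₂ b≼a = a , inj₁ refl , irrefl a , b≼a

  -- `⊥` is the value when no entry of `L` satisfies `S`. It is later an infinite endpoint, so a cut
  -- bounded on one side only needs no separate treatment.
  supremum-in : ∀ ⊥ → (∀ x → ⊥ ≼ x) → (S : X → Set ℓ) (L : List X) →
    Σ X λ s → (s ≡ ⊥ ⊎ S s) × (∀ x → x ∈ L → S x → x ≼ s)
  supremum-in ⊥ least S [] = ⊥ , inj₁ refl , λ _ ()
  supremum-in ⊥ least S (y ∷ L) with supremum-in ⊥ least S L | em {S y}
  ... | s , s∈ , ub | no ¬Sy = s , s∈ , λ where
    x (here refl) Sx → ⊥-elim (¬Sy Sx)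
    x (there x∈L) Sx → ub x x∈L Sx
  ... | s , s∈ , ub | yes Sy with maximum y s
  ...   | c , c≡ , y≼c , s≼c = c , attained c≡ , λ where
            x (here refl) Sx → y≼c
            x (there x∈L) Sx c<x → ub x x∈L Sx (≼-<-trans s c x s≼c c<x)
    where
    attained : c ≡ y ⊎ c ≡ s → c ≡ ⊥ ⊎ S c
    attained (inj₁ refl) = inj₂ Sy
    attained (inj₂ refl) = s∈

  supremum : ∀ ⊥ → (∀ x → ⊥ ≼ x) → (S : X → Set ℓ) (L : List X) → (∀ {x} → S x → x ∈ L) →
    Σ X λ s → (s ≡ ⊥ ⊎ S s) × (∀ x → S x → x ≼ s)
  supremum ⊥ least S L S⊆L with supremum-in ⊥ least S L
  ... | s , s∈ , ub = s , s∈ , λ x Sx → ub x (S⊆L Sx) Sx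

-- Finite products of lists.

choices : ∀ {ℓ : Level} {n : ℕ} {X : Fin n → Set ℓ} → (∀ i → List (X i)) → List (∀ i → X i)
choices {n = ℕ.zero} L = (λ ()) ∷ []
choices {n = ℕ.suc n} L = cartesianProductWith (λ a h → λ { zero → a ; (suc i) → h i })
  (L zero) (choices (L ∘ suc))

-- Membership is up to pointwise equality, since function extensionality is not assumed.
∈-choices : ∀ {ℓ : Level} {n : ℕ} {X : Fin n → Set ℓ} (L : ∀ i → List (X i)) (h : ∀ i → X i) →
  (∀ i → h i ∈ L i) → Any (λ h′ → ∀ i → h′ i ≡ h i) (choices L)
∈-choices {n = ℕ.zero} L h h∈ = here λ ()
∈-choices {n = ℕ.suc n} L h h∈ =
  let k , k∈ , k≡h = find (∈-choices (L ∘ suc) (h ∘ suc) (h∈ ∘ suc))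
  in lose (∈-cartesianProductWith⁺ _ (h∈ zero) k∈) λ { zero → refl ; (suc i) → k≡h i }

module Model {ℓ : Level} (em : ExcludedMiddle ℓ) {n : ℕ} (i₀ : Fin n)
  (M : Structure n ℓ) (vo : IsVO M) where

  open Structure M
  open IsVO vo

  private module O (i : Fin n) = IsStrictTotalOrder (order i)

  -- The orders with infinite endpoints adjoined.

  _<ᵉ_ : ∀ {i} → Ext (Car (suc i)) → Ext (Car (suc i)) → Set ℓ
  _<ᵉ_ {i} = ltE M i

  <ᵉ-irrefl : ∀ {i} (p : Ext (Car (suc i))) → ¬ (p <ᵉ p)
  <ᵉ-irrefl (fin a) = O.irrefl _ refl

  <ᵉ-trans : ∀ {i} (p q r : Ext (Car (suc i))) → p <ᵉ q → q <ᵉ r → p <ᵉ r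
  <ᵉ-trans -∞      (fin _) (fin _) _ _ = _
  <ᵉ-trans -∞      (fin _) +∞      _ _ = _
  <ᵉ-trans (fin _) (fin _) (fin _) a<b b<c = O.trans _ a<b b<c
  <ᵉ-trans (fin _) (fin _) +∞      _ _ = _

  <ᵉ-compare : ∀ {i} → Trichotomous _≡_ (_<ᵉ_ {i})
  <ᵉ-compare -∞      -∞      = tri≈ (λ ()) refl λ ()
  <ᵉ-compare -∞      (fin _) = tri< _ (λ ()) λ ()
  <ᵉ-compare -∞      +∞      = tri< _ (λ ()) λ ()
  <ᵉ-compare (fin _) -∞      = tri> (λ ()) (λ ()) _
  <ᵉ-compare (fin a) (fin b) with O.compare _ a b
  ... | tri< a<b a≢b b≮a = tri< a<b (λ { refl → a≢b refl }) b≮a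
  ... | tri≈ a≮b refl b≮a = tri≈ a≮b refl b≮a
  ... | tri> a≮b a≢b b<a = tri> a≮b (λ { refl → a≢b refl }) b<a
  <ᵉ-compare (fin _) +∞      = tri< _ (λ ()) λ ()
  <ᵉ-compare +∞      -∞      = tri> (λ ()) (λ ()) _
  <ᵉ-compare +∞      (fin _) = tri> (λ ()) (λ ()) _
  <ᵉ-compare +∞      +∞      = tri≈ (λ ()) refl λ ()

  <ᵉ-order : ∀ i → IsStrictTotalOrder _≡_ (_<ᵉ_ {i})
  <ᵉ-order i = record
    { isStrictPartialOrder = record
        { isEquivalence = isEquivalence
        ; irrefl = λ { {p} refl → <ᵉ-irrefl p }
        ; trans = λ {p} {q} {r} → <ᵉ-trans p q r
        ; <-resp-≈ = resp₂ _<ᵉ_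
        }
    ; compare = <ᵉ-compare
    }

  module Up (i : Fin n) = LinearOrder em (<ᵉ-order i)
  -- The reversed order: Down.maximum is a minimum and Down.supremum an infimum.
  module Down (i : Fin n) = LinearOrder em (Flip.isStrictTotalOrder (<ᵉ-order i))

  -∞-least : ∀ {i} (p : Ext (Car (suc i))) → ¬ (p <ᵉ -∞)
  -∞-least -∞ ()
  -∞-least (fin _) ()
  -∞-least +∞ ()

  +∞-greatest : ∀ {i} (p : Ext (Car (suc i))) → ¬ (+∞ <ᵉ p)
  +∞-greatest _ ()

  <ᵉ-dense : ∀ {i} (p q : Ext (Car (suc i))) → p <ᵉ q →
    Σ (Car (suc i)) λ z → p <ᵉ fin z × fin z <ᵉ q
  <ᵉ-dense -∞ (fin b) _ = let c , c<b = no-min _ b in c , _ , c<b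
  <ᵉ-dense -∞ +∞ _ = f _ zer , _ , _
  <ᵉ-dense (fin a) (fin b) a<b = dense _ a b a<b
  <ᵉ-dense (fin a) +∞ _ = let c , a<c = no-max _ a in c , a<c , _

  subinterval : ∀ {i} (p q : Ext (Car (suc i))) → p <ᵉ q →
    Σ (Car (suc i)) λ u → Σ (Car (suc i)) λ v → p <ᵉ fin u × lt i u v × fin v <ᵉ q
  subinterval p q p<q =
    let u , p<u , u<q = <ᵉ-dense p q p<q
        v , u<v , v<q = <ᵉ-dense (fin u) q u<q
    in u , v , p<u , u<v , v<q

  -- Finite partial isomorphisms.

  data Agree (i : Fin n) (a a′ b b′ : Car (suc i)) : Set ℓ where
    below : lt i a b → lt i a′ b′ → Agree i a a′ b b′
    same  : a ≡ b → a′ ≡ b′ → Agree i a a′ b b′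
    above : lt i b a → lt i b′ a′ → Agree i a a′ b b′

  agree-swap : ∀ {i a a′ b b′} → Agree i a a′ b b′ → Agree i a′ a b′ b
  agree-swap (below p q) = below q p
  agree-swap (same p q)  = same q p
  agree-swap (above p q) = above q p

  agree-sym : ∀ {i a a′ b b′} → Agree i a a′ b b′ → Agree i b b′ a a′
  agree-sym (below p q) = above p q
  agree-sym (same p q)  = same (sym p) (sym q)
  agree-sym (above p q) = below p q

  agree-< : ∀ {i a a′ b b′} → Agree i a a′ b b′ → lt i a b → lt i a′ b′
  agree-< (below _ q)    _   = q
  agree-< (same refl _)  a<b = ⊥-elim (O.irrefl _ refl a<b)
  agree-< (above p _)    a<b = ⊥-elim (O.asym _ p a<b)

  agree-≡ : ∀ {i a a′ b b′} → Agree i a a′ b b′ → a ≡ b → a′ ≡ b′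
  agree-≡ (below p _) refl = ⊥-elim (O.irrefl _ refl p)
  agree-≡ (same _ q)  _    = q
  agree-≡ (above p _) refl = ⊥-elim (O.irrefl _ refl p)

  Pairs : Set ℓ
  Pairs = List (Σ (Sort n) λ s → Car s × Car s)

  record Closed (P : Pairs) : Set ℓ where
    field
      f-closed : ∀ i {x x′} → (zero , x , x′) ∈ P → (suc i , f i x , f i x′) ∈ P
      g-closed : ∀ i {y y′} → (suc i , y , y′) ∈ P → (zero , g i y , g i y′) ∈ P
  open Closed

  closed-[] : Closed []
  closed-[] .f-closed i ()
  closed-[] .g-closed i ()

  closed-∷ : ∀ {P i y y′} → Closed P → (zero , g i y , g i y′) ∈ P →
    Closed ((suc i , y , y′) ∷ P)
  closed-∷ c gy∈P .f-closed i (there x∈P) = there (f-closed c i x∈P)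
  closed-∷ c gy∈P .g-closed i (here refl) = there gy∈P
  closed-∷ c gy∈P .g-closed i (there y∈P) = there (g-closed c i y∈P)

  -- Adjoining `x` generates only `x` and the `f i x`, because `g i` sends `f i x` back to `x`. This
  -- keeps every closure finite.
  orbit : Car zero → Car zero → Pairs
  orbit x x′ = (zero , x , x′) ∷ map (λ i → suc i , f i x , f i x′) (allFin n)

  data InOrbit (x x′ : Car zero) : (s : Sort n) → Car s → Car s → Set ℓ where
    root : InOrbit x x′ zero x x′
    leaf : ∀ i → InOrbit x x′ (suc i) (f i x) (f i x′)

  ∈-orbit⁺ : ∀ {x x′ s y y′} → InOrbit x x′ s y y′ → (s , y , y′) ∈ orbit x x′
  ∈-orbit⁺ root     = here refl
  ∈-orbit⁺ (leaf i) = there (∈-map⁺ _ (∈-allFin i))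

  ∈-orbit⁻ : ∀ {x x′ s y y′} → (s , y , y′) ∈ orbit x x′ → InOrbit x x′ s y y′
  ∈-orbit⁻ (here refl) = root
  ∈-orbit⁻ (there p) with ∈-map⁻ _ p
  ... | i , _ , refl = leaf i

  closed-orbit : ∀ {P} x x′ → Closed P → Closed (orbit x x′ ++ P)
  closed-orbit x x′ c .f-closed i p with ∈-++⁻ (orbit x x′) p
  ... | inj₂ q = ∈-++⁺ʳ _ (f-closed c i q)
  ... | inj₁ q with ∈-orbit⁻ q
  ...   | root = ∈-++⁺ˡ (∈-orbit⁺ (leaf i))
  closed-orbit x x′ c .g-closed i p with ∈-++⁻ (orbit x x′) p
  ... | inj₂ q = ∈-++⁺ʳ _ (g-closed c i q)
  ... | inj₁ q with ∈-orbit⁻ q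
  ...   | leaf i rewrite g-image i x _ refl | g-image i x′ _ refl = here refl

  -- Single-valuedness and injectivity are contained in `agree`: its `same` case gives both on the
  -- ordered sorts, and `f-closed` with injectivity of `f` carries them to sort `zero`.
  record PartialIso (P : Pairs) : Set ℓ where
    field
      closed : Closed P
      zer∈   : (zero , zer , zer) ∈ P
      agree  : ∀ i {a a′ b b′} → (suc i , a , a′) ∈ P → (suc i , b , b′) ∈ P →
               Agree i a a′ b b′
  open PartialIso

  converse : Pairs → Pairs
  converse = map λ (s , x , x′) → s , x′ , x

  ∈-converse⁺ : ∀ {P s x x′} → (s , x , x′) ∈ P → (s , x′ , x) ∈ converse P
  ∈-converse⁺ = ∈-map⁺ _

  ∈-converse⁻ : ∀ {P s x x′} → (s , x′ , x) ∈ converse P → (s , x , x′) ∈ P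
  ∈-converse⁻ p with ∈-map⁻ _ p
  ... | _ , q , refl = q

  converse-iso : ∀ {P} → PartialIso P → PartialIso (converse P)
  converse-iso π .closed .f-closed i p = ∈-converse⁺ (f-closed (closed π) i (∈-converse⁻ p))
  converse-iso π .closed .g-closed i p = ∈-converse⁺ (g-closed (closed π) i (∈-converse⁻ p))
  converse-iso π .zer∈ = ∈-converse⁺ (zer∈ π)
  converse-iso π .agree i p q = agree-swap (agree π i (∈-converse⁻ p) (∈-converse⁻ q))

  -- Agreement has to be checked against old pairs only: an orbit contributes a single pair to each
  -- ordered sort.
  extend-orbit : ∀ {P x x′} → PartialIso P →
    (∀ i {a a′} → (suc i , a , a′) ∈ P → Agree i a a′ (f i x) (f i x′)) →
    PartialIso (orbit x x′ ++ P)
  extend-orbit π _ .closed = closed-orbit _ _ (closed π)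
  extend-orbit π _ .zer∈ = ∈-++⁺ʳ _ (zer∈ π)
  extend-orbit {P} {x} {x′} π ag .agree i p q with ∈-++⁻ (orbit x x′) p | ∈-++⁻ (orbit x x′) q
  ... | inj₂ p∈ | inj₂ q∈ = agree π i p∈ q∈
  ... | inj₂ p∈ | inj₁ q∈ with ∈-orbit⁻ q∈
  ...   | leaf i = ag i p∈
  extend-orbit {P} {x} {x′} π ag .agree i p q | inj₁ p∈ | inj₂ q∈ with ∈-orbit⁻ p∈
  ...   | leaf i = agree-sym (ag i q∈)
  extend-orbit {P} {x} {x′} π ag .agree i p q | inj₁ p∈ | inj₁ q∈ with ∈-orbit⁻ p∈ | ∈-orbit⁻ q∈
  ...   | leaf i | leaf i = same refl refl

  -- Outside the image of `f i` the value of `g i` is `zer`, so closure under `g i` asks only for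
  -- the pair of zeros, which is already present.
  extend-point : ∀ {P i y y′} → PartialIso P → g i y ≡ zer → g i y′ ≡ zer →
    (∀ {a a′} → (suc i , a , a′) ∈ P → Agree i a a′ y y′) → PartialIso ((suc i , y , y′) ∷ P)
  extend-point π gy gy′ _ .closed =
    closed-∷ (closed π) (subst₂ (λ x x′ → (zero , x , x′) ∈ _) (sym gy) (sym gy′) (zer∈ π))
  extend-point π _ _ _ .zer∈ = there (zer∈ π)
  extend-point π _ _ ag .agree i (here refl) (here refl) = same refl refl
  extend-point π _ _ ag .agree i (here refl) (there q) = agree-sym (ag q)
  extend-point π _ _ ag .agree i (there p) (here refl) = ag p
  extend-point π _ _ ag .agree i (there p) (there q) = agree π i p q

  -- Cuts and the back-and-forth property.

  ends : ∀ i → Pairs → List (Ext (Car (suc i)))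
  ends i [] = []
  ends i ((s , _ , y) ∷ P) with s ≟ᶠ suc i
  ... | yes refl = fin y ∷ ends i P
  ... | no _ = ends i P

  ∈-ends : ∀ {i P a a′} → (suc i , a , a′) ∈ P → fin a′ ∈ ends i P
  ∈-ends {i} (here refl) with suc i ≟ᶠ suc i
  ... | yes refl = here refl
  ... | no i≢i = ⊥-elim (i≢i refl)
  ∈-ends {i} {(s , _) ∷ P} (there p) with s ≟ᶠ suc i
  ... | yes refl = there (∈-ends p)
  ... | no _ = ∈-ends p

  -- Let `lo` be the largest partner of an element below `y` and `hi` the smallest partner of one
  -- above; `agree` gives `lo <ᵉ hi`. The possibly infinite interval is then shrunk to endpoints
  -- `u`, `v` in the model, as `simult` and `img-codense` take only such endpoints.
  cut : ∀ {P} → PartialIso P → ∀ i y → (∀ {a a′} → (suc i , a , a′) ∈ P → a ≢ y) →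
    Σ (Car (suc i)) λ u → Σ (Car (suc i)) λ v → lt i u v ×
      (∀ {z} → lt i u z → lt i z v → ∀ {a a′} → (suc i , a , a′) ∈ P → Agree i a a′ y z)
  cut {P} π i y y∉ =
    let lo , lo∈ , lo-ub = Up.supremum i -∞ -∞-least Lower (ends i P)
                             λ { (_ , _ , refl , p , _) → ∈-ends p }
        hi , hi∈ , hi-lb = Down.supremum i +∞ +∞-greatest Upper (ends i P)
                             λ { (_ , _ , refl , p , _) → ∈-ends p }
        u , v , lo<u , u<v , v<hi = subinterval lo hi (lo<hi lo∈ hi∈)
    in u , v , u<v , λ {z} u<z z<v {a} {a′} p → case O.compare i a y of λ where
         (tri< a<y _ _) → below a<y (Up.≼-<-trans i (fin a′) lo (fin z)
            (lo-ub (fin a′) (a , a′ , refl , p , a<y)) (<ᵉ-trans lo (fin u) (fin z) lo<u u<z))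
         (tri≈ _ a≡y _) → ⊥-elim (y∉ p a≡y)
         (tri> _ _ y<a) → above y<a (Up.<-≼-trans i (fin z) hi (fin a′)
            (<ᵉ-trans (fin z) (fin v) hi z<v v<hi) (hi-lb (fin a′) (a , a′ , refl , p , y<a)))
    where
    Lower Upper : Ext (Car (suc i)) → Set ℓ
    Lower e = Σ _ λ a → Σ _ λ a′ → e ≡ fin a′ × (suc i , a , a′) ∈ P × lt i a y
    Upper e = Σ _ λ a → Σ _ λ a′ → e ≡ fin a′ × (suc i , a , a′) ∈ P × lt i y a
    lo<hi : ∀ {lo hi} → lo ≡ -∞ ⊎ Lower lo → hi ≡ +∞ ⊎ Upper hi → lo <ᵉ hi
    lo<hi (inj₁ refl) (inj₁ refl) = _
    lo<hi (inj₁ refl) (inj₂ (_ , _ , refl , _)) = _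
    lo<hi (inj₂ (_ , _ , refl , _)) (inj₁ refl) = _
    lo<hi (inj₂ (_ , _ , refl , p , a<y)) (inj₂ (_ , _ , refl , q , y<b)) =
      agree-< (agree π i p q) (O.trans i a<y y<b)

  forth : ∀ {P} → PartialIso P → ∀ s x → Σ Pairs λ Q → Σ (Car s) λ x′ →
    PartialIso Q × (∀ {t} → t ∈ P → t ∈ Q) × (s , x , x′) ∈ Q
  forth {P} π zero x with em {Σ (Car zero) λ x′ → (zero , x , x′) ∈ P}
  ... | yes (x′ , p) = P , x′ , π , (λ t∈P → t∈P) , p
  ... | no x∉P =
    orbit x x′ ++ P , x′ ,
    extend-orbit π (λ i → let _ , _ , _ , ag = cuts i in ag (proj₁ (x′-cut i)) (proj₂ (x′-cut i))) ,
    ∈-++⁺ʳ _ , here refl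
    where
    -- If `f i x` were already matched, closure under `g i` would match `x` as well.
    cuts = λ i → cut π i (f i x) λ {a} {a′} p a≡fx →
      x∉P (g i a′ , subst (λ z → (zero , z , g i a′) ∈ P) (g-image i x a (sym a≡fx))
                      (g-closed (closed π) i p))
    -- One point realises all the cuts at once.
    point = simult (λ i → proj₁ (cuts i)) (λ i → proj₁ (proj₂ (cuts i)))
                   (λ i → proj₁ (proj₂ (proj₂ (cuts i))))
    x′ = proj₁ point
    x′-cut = proj₂ point
  forth {P} π (suc i) y with em {Σ (Car (suc i)) λ y′ → (suc i , y , y′) ∈ P}
  ... | yes (y′ , p) = P , y′ , π , (λ t∈P → t∈P) , p
  ... | no y∉P with em {Σ (Car zero) λ x → f i x ≡ y}
  ...   | yes (x , refl) =
    let Q , x′ , ρ , P⊆Q , p = forth π zero x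
    in Q , f i x′ , ρ , P⊆Q , f-closed (closed ρ) i p
  ...   | no y∉im =
    -- The partner is also taken outside the image, so that `g i` is `zer` on both sides.
    let u , v , u<v , ag = cut π i y λ { {_} {a′} p refl → y∉P (a′ , p) }
        y′ , u<y′ , y′<v , y′∉im = img-codense i u v u<v
    in (suc i , y , y′) ∷ P , y′ ,
       extend-point π (g-else i y λ x fx≡y → y∉im (x , fx≡y)) (g-else i y′ y′∉im) (ag u<y′ y′<v) ,
       there , here refl

  back : ∀ {P} → PartialIso P → ∀ s x′ → Σ Pairs λ Q → Σ (Car s) λ x →
    PartialIso Q × (∀ {t} → t ∈ P → t ∈ Q) × (s , x , x′) ∈ Q
  back π s x′ =
    let Q , x , ρ , P⊆Q , p = forth (converse-iso π) s x′
    in converse Q , x , converse-iso ρ , (λ t∈P → ∈-converse⁺ (P⊆Q (∈-converse⁺ t∈P))) , ∈-converse⁺ p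

  -- Transfer of formulas along partial isomorphisms.

  Related : ∀ {Γ} → Pairs → Env M Γ → Env M Γ → Set ℓ
  Related {Γ} P ρ ρ′ = ∀ {s} (v : s ∈ Γ) → (s , All.lookup ρ v , All.lookup ρ′ v) ∈ P

  related-∷ : ∀ {Γ P Q s x x′} {ρ ρ′ : Env M Γ} → Related P ρ ρ′ → (∀ {t} → t ∈ P → t ∈ Q) →
    (s , x , x′) ∈ Q → Related Q (x All.∷ ρ) (x′ All.∷ ρ′)
  related-∷ rel P⊆Q p (here refl) = p
  related-∷ rel P⊆Q p (there v) = P⊆Q (rel v)

  related-term : ∀ {Γ P s} {ρ ρ′ : Env M Γ} → PartialIso P → Related P ρ ρ′ →
    (t : Term Γ s) → (s , evalT M t ρ , evalT M t ρ′) ∈ P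
  related-term π rel (var v)  = rel v
  related-term π rel c0       = zer∈ π
  related-term π rel (tf i t) = f-closed (closed π) i (related-term π rel t)
  related-term π rel (tg i t) = g-closed (closed π) i (related-term π rel t)

  -- Sort R_0 carries no order; equality there is read off in R_{i₀} through f_{i₀}, which needs n ≥ 1.
  functional : ∀ {P} → PartialIso P → ∀ s {a a′ b b′} → (s , a , a′) ∈ P → (s , b , b′) ∈ P →
    a ≡ b → a′ ≡ b′
  functional π zero p q a≡b = f-inj i₀
    (agree-≡ (agree π i₀ (f-closed (closed π) i₀ p) (f-closed (closed π) i₀ q)) (cong (f i₀) a≡b))
  functional π (suc i) p q = agree-≡ (agree π i p q)

  -- Induction on the formula. Negations and premises reverse direction and use the converse
  -- isomorphism; `ex` uses `forth` and `all` uses `back`.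
  transfer : ∀ {Γ P} {ρ ρ′ : Env M Γ} (φ : Formula Γ) → PartialIso P → Related P ρ ρ′ →
    Sat M φ ρ → Sat M φ ρ′
  transfer tt π rel _ = _
  transfer (eq {s = s} t u) π rel = functional π s (related-term π rel t) (related-term π rel u)
  transfer (less i t u) π rel = agree-< (agree π i (related-term π rel t) (related-term π rel u))
  transfer (neg φ) π rel ¬φ φ′ = ¬φ (transfer φ (converse-iso π) (λ v → ∈-converse⁺ (rel v)) φ′)
  transfer (and φ ψ) π rel (p , q) = transfer φ π rel p , transfer ψ π rel q
  transfer (or φ ψ) π rel (inj₁ p) = inj₁ (transfer φ π rel p)
  transfer (or φ ψ) π rel (inj₂ q) = inj₂ (transfer ψ π rel q)
  transfer (imp φ ψ) π rel φ⇒ψ φ′ = transfer ψ π rel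
    (φ⇒ψ (transfer φ (converse-iso π) (λ v → ∈-converse⁺ (rel v)) φ′))
  transfer (all s φ) π rel h x′ =
    let _ , x , ρ , P⊆Q , p = back π s x′ in transfer φ ρ (related-∷ rel P⊆Q p) (h x)
  transfer (ex s φ) π rel (x , h) =
    let _ , x′ , ρ , P⊆Q , p = forth π s x in x′ , transfer φ ρ (related-∷ rel P⊆Q p) h

  -- The substructure generated by the parameters, and invariance of definable sets.

  -- The identity of ⟨A⟩, as a list of pairs.
  closure : Params M → Pairs
  closure [] = orbit zer zer ++ []
  closure ((zero , x) ∷ A) = orbit x x ++ closure A
  closure ((suc i , y) ∷ A) = (suc i , y , y) ∷ (orbit (g i y) (g i y) ++ closure A)

  closure-closed : ∀ A → Closed (closure A)
  closure-closed [] = closed-orbit zer zer closed-[]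
  closure-closed ((zero , x) ∷ A) = closed-orbit x x (closure-closed A)
  closure-closed ((suc i , y) ∷ A) = closed-∷ (closed-orbit _ _ (closure-closed A)) (here refl)

  zer∈closure : ∀ A → (zero , zer , zer) ∈ closure A
  zer∈closure [] = here refl
  zer∈closure ((zero , x) ∷ A) = ∈-++⁺ʳ (orbit x x) (zer∈closure A)
  zer∈closure ((suc i , y) ∷ A) = there (∈-++⁺ʳ (orbit (g i y) (g i y)) (zer∈closure A))

  ∈-closure⁺ : ∀ A {s a} → (s , a) ∈ A → (s , a , a) ∈ closure A
  ∈-closure⁺ ((zero , x) ∷ A) (here refl) = here refl
  ∈-closure⁺ ((zero , x) ∷ A) (there p) = ∈-++⁺ʳ (orbit x x) (∈-closure⁺ A p)
  ∈-closure⁺ ((suc i , y) ∷ A) (here refl) = here refl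
  ∈-closure⁺ ((suc i , y) ∷ A) (there p) = there (∈-++⁺ʳ (orbit (g i y) (g i y)) (∈-closure⁺ A p))

  Diagonal : Params M → Pairs → Set ℓ
  Diagonal B P = ∀ {s a a′} → (s , a , a′) ∈ P → a ≡ a′ × Gen M B s a

  diagonal-orbit : ∀ {B P} x → Gen M B zero x → Diagonal B P → Diagonal B (orbit x x ++ P)
  diagonal-orbit x gx d p with ∈-++⁻ (orbit x x) p
  ... | inj₂ q = d q
  ... | inj₁ q with ∈-orbit⁻ q
  ...   | root = refl , gx
  ...   | leaf i = refl , genf i gx

  -- The generating set `B` stays fixed while the recursion shortens `A`; for `B` equal to `A` the
  -- hypothesis is `base`.
  closure-diagonal : ∀ {B} A → (∀ {s a} → (s , a) ∈ A → Gen M B s a) → Diagonal B (closure A)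
  closure-diagonal [] _ = diagonal-orbit zer gen0 λ ()
  closure-diagonal ((zero , x) ∷ A) h =
    diagonal-orbit x (h (here refl)) (closure-diagonal A (h ∘ there))
  closure-diagonal ((suc i , y) ∷ A) h (here refl) = refl , h (here refl)
  closure-diagonal ((suc i , y) ∷ A) h (there p) =
    diagonal-orbit _ (geng i (h (here refl))) (closure-diagonal A (h ∘ there)) p

  closure-iso : ∀ A → PartialIso (closure A)
  closure-iso A .closed = closure-closed A
  closure-iso A .zer∈ = zer∈closure A
  closure-iso A .agree i {a} {_} {b} p q with closure-diagonal A base p | closure-diagonal A base q
  ... | refl , _ | refl , _ with O.compare i a b
  ...   | tri< a<b _ _ = below a<b a<b
  ...   | tri≈ _ a≡b _ = same a≡b a≡b
  ...   | tri> _ _ b<a = above b<a b<a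

  SameCut : Pairs → Car zero → Car zero → Set ℓ
  SameCut C x x′ = ∀ i {c} → (suc i , c , c) ∈ C → Agree i c c (f i x) (f i x′)

  -- Equal cuts say exactly that the identity of `closure A` extends by sending `x` to `x′`. The
  -- extension fixes the parameters, so `transfer` applies to the defining formula.
  definable-invariant : ∀ {A E} → Definable M A E → ∀ {x x′} → SameCut (closure A) x x′ →
    E x → E x′
  definable-invariant {A} (Γ , φ , ρ , ρ∈A , E⇔φ) {x} {x′} cut Ex =
    proj₂ (E⇔φ x′) (transfer φ
      (extend-orbit (closure-iso A) λ i p →
        case closure-diagonal A base p of λ { (refl , _) → cut i p })
      (related-∷ (λ v → ∈-closure⁺ A (ρ∈A _ v)) (∈-++⁺ʳ (orbit x x′)) (here refl))
      (proj₁ (E⇔φ x) Ex))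

  -- Intervals: extensionality, hulls and intersections.

  In : ∀ {i} → Car (suc i) → Interval M i → Set ℓ
  In = _∈I_ M

  -- Otherwise density gives a point between `lo` and `lo′`. It lies below `p`, hence in `J`, but
  -- not in `J′`.
  lower-≼ : ∀ {i} (J J′ : Interval M i) → NonEmptyI M J → _⊆I_ M J J′ →
    ¬ (proj₁ J <ᵉ proj₁ J′)
  lower-≼ {i} (lo , hi) (lo′ , _) (p , p∈) J⊆J′ lo<lo′ =
    let z , lo<z , z<lo′ = <ᵉ-dense lo lo′ lo<lo′
        lo′<p = proj₁ (J⊆J′ p p∈)
        z<hi = <ᵉ-trans (fin z) (fin p) hi (<ᵉ-trans (fin z) lo′ (fin p) z<lo′ lo′<p) (proj₂ p∈)
    in IsStrictTotalOrder.asym (<ᵉ-order i) {lo′} {fin z} (proj₁ (J⊆J′ z (lo<z , z<hi))) z<lo′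

  upper-≼ : ∀ {i} (J J′ : Interval M i) → NonEmptyI M J → _⊆I_ M J J′ →
    ¬ (proj₂ J′ <ᵉ proj₂ J)
  upper-≼ {i} (lo , hi) (_ , hi′) (p , p∈) J⊆J′ hi′<hi =
    let z , hi′<z , z<hi = <ᵉ-dense hi′ hi hi′<hi
        p<hi′ = proj₂ (J⊆J′ p p∈)
        lo<z = <ᵉ-trans lo (fin p) (fin z) (proj₁ p∈) (<ᵉ-trans (fin p) hi′ (fin z) p<hi′ hi′<z)
    in IsStrictTotalOrder.asym (<ᵉ-order i) {hi′} {fin z} hi′<z (proj₂ (J⊆J′ z (lo<z , z<hi)))

  -- Maximality yields inclusions of point sets, whereas boxes are compared by their endpoints;
  -- nonemptiness bridges the two.
  interval-ext : ∀ {i} {J J′ : Interval M i} → NonEmptyI M J → _⊆I_ M J J′ → _⊆I_ M J′ J → J ≡ J′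
  interval-ext {i} {J@(lo , hi)} {J′@(lo′ , hi′)} (p , p∈) J⊆J′ J′⊆J = cong₂ _,_
    (Up.≼-antisym i lo lo′ (lower-≼ J′ J (p , J⊆J′ p p∈) J′⊆J) (lower-≼ J J′ (p , p∈) J⊆J′))
    (Up.≼-antisym i hi hi′ (upper-≼ J J′ (p , p∈) J⊆J′) (upper-≼ J′ J (p , J⊆J′ p p∈) J′⊆J))

  -- The common point `p` makes the union convex: a point left of `p` lies in the interval that
  -- supplied the lower endpoint, a point right of `p` in the one that supplied the upper.
  hull : ∀ {i} (J J′ : Interval M i) {p} → In p J → In p J′ →
    Σ (Interval M i) λ H → In p H × (∀ {y} → In y H → In y J ⊎ In y J′) × _⊆I_ M J H × _⊆I_ M J′ H
  hull {i} (lo , hi) (lo′ , hi′) {p} (lo<p , p<hi) (lo′<p , p<hi′) =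
    let a , a≡ , a≼lo , a≼lo′ = Down.maximum i lo lo′
        b , b≡ , hi≼b , hi′≼b = Up.maximum i hi hi′
    in (a , b) ,
       (Up.≼-<-trans i a lo (fin p) a≼lo lo<p , Up.<-≼-trans i (fin p) hi b p<hi hi≼b) ,
       (λ {y} → λ (a<y , y<b) → covered y a<y y<b a≡ b≡) ,
       (λ y (lo<y , y<hi) →
          Up.≼-<-trans i a lo (fin y) a≼lo lo<y , Up.<-≼-trans i (fin y) hi b y<hi hi≼b) ,
       (λ y (lo<y , y<hi) →
          Up.≼-<-trans i a lo′ (fin y) a≼lo′ lo<y , Up.<-≼-trans i (fin y) hi′ b y<hi hi′≼b)
    where
    covered : ∀ y {a b} → a <ᵉ fin y → fin y <ᵉ b → a ≡ lo ⊎ a ≡ lo′ → b ≡ hi ⊎ b ≡ hi′ →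
      In y (lo , hi) ⊎ In y (lo′ , hi′)
    covered y a<y y<b a≡ b≡ with O.compare i y p
    covered y a<y y<b (inj₁ refl) b≡ | tri< y<p _ _ = inj₁ (a<y , <ᵉ-trans (fin y) (fin p) hi y<p p<hi)
    covered y a<y y<b (inj₂ refl) b≡ | tri< y<p _ _ = inj₂ (a<y , <ᵉ-trans (fin y) (fin p) hi′ y<p p<hi′)
    covered y a<y y<b a≡ b≡ | tri≈ _ refl _ = inj₁ (lo<p , p<hi)
    covered y a<y y<b a≡ (inj₁ refl) | tri> _ _ p<y = inj₁ (<ᵉ-trans lo (fin p) (fin y) lo<p p<y , y<b)
    covered y a<y y<b a≡ (inj₂ refl) | tri> _ _ p<y = inj₂ (<ᵉ-trans lo′ (fin p) (fin y) lo′<p p<y , y<b)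

  meet : ∀ {i} (J J′ : Interval M i) →
    Σ (Interval M i) λ H → (∀ {y} → In y J → In y J′ → In y H) × _⊆I_ M H J × _⊆I_ M H J′
  meet {i} (lo , hi) (lo′ , hi′) =
    let a , a≡ , lo≼a , lo′≼a = Up.maximum i lo lo′
        b , b≡ , b≼hi , b≼hi′ = Down.maximum i hi hi′
    in (a , b) , (λ y∈ y∈′ → greater a≡ (proj₁ y∈) (proj₁ y∈′) , lesser b≡ (proj₂ y∈) (proj₂ y∈′)) ,
       (λ y (a<y , y<b) →
          Up.≼-<-trans i lo a (fin y) lo≼a a<y , Up.<-≼-trans i (fin y) b hi y<b b≼hi) ,
       (λ y (a<y , y<b) →
          Up.≼-<-trans i lo′ a (fin y) lo′≼a a<y , Up.<-≼-trans i (fin y) b hi′ y<b b≼hi′)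
    where
    greater : ∀ {y a} → a ≡ lo ⊎ a ≡ lo′ → lo <ᵉ fin y → lo′ <ᵉ fin y → a <ᵉ fin y
    greater (inj₁ refl) p _ = p
    greater (inj₂ refl) _ p = p
    lesser : ∀ {y b} → b ≡ hi ⊎ b ≡ hi′ → fin y <ᵉ hi → fin y <ᵉ hi′ → fin y <ᵉ b
    lesser (inj₁ refl) p _ = p
    lesser (inj₂ refl) _ p = p

  -- Maximality and uniqueness of the decomposition.

  good-cong : ∀ {E e I I′ m J} → (∀ l → l <ᶠ m → I l ≡ I′ l) → Good M E e I m J → Good M E e I′ m J
  good-cong I≡I′ (K , K≡I , rest) = K , (λ l l<m → trans (K≡I l l<m) (I≡I′ l l<m)) , rest

  -- `Good` requires membership of `e` only from coordinate `m` upwards; below `m` it is inherited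
  -- from `K`.
  good-∈ : ∀ {e m} {K G : Box M} → _∈B_ M e K → (∀ l → l <ᶠ m → G l ≡ K l) →
    (∀ j → m <ᶠ j → In (f j e) (G j)) → In (f m e) (G m) → _∈B_ M e G
  good-∈ {e} {m} e∈K G≡K e∈above e∈Gm j with <-cmp j m
  ... | tri< j<m _ _ = subst (In (f j e)) (sym (G≡K j j<m)) (e∈K j)
  ... | tri≈ _ refl _ = e∈Gm
  ... | tri> _ _ m<j = e∈above j m<j

  maxMI-unique : ∀ {E e I I′} → MaxMI M E e I → MaxMI M E e I′ → ∀ m → I m ≡ I′ m
  maxMI-unique {E} {e} {I} {I′} (ne , _ , _ , max) (_ , _ , _ , max′) m = go m (<-wellFounded m)
    where
    go : ∀ m → Acc _<ᶠ_ m → I m ≡ I′ m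
    -- Agreement below `m` makes each of `I m` and `I′ m` an admissible competitor of the other.
    go m (acc rec) = interval-ext (ne m)
      (proj₂ (max′ m) (I m) (good-cong (λ l l<m → go l (rec l<m)) (proj₁ (max m))))
      (proj₂ (max m) (I′ m) (good-cong (λ l l<m → sym (go l (rec l<m))) (proj₁ (max′ m))))

  maxMI-resp : ∀ {E e I I′} → (∀ i → I i ≡ I′ i) → MaxMI M E e I → MaxMI M E e I′
  maxMI-resp {E} {e} {I} {I′} I≡I′ (ne , e∈I , I⊆E , max) =
    (λ i → subst (NonEmptyI M) (I≡I′ i) (ne i)) ,
    (λ i → subst (In _) (I≡I′ i) (e∈I i)) ,
    (λ x x∈ → I⊆E x λ i → subst (In _) (sym (I≡I′ i)) (x∈ i)) ,
    λ m → good-cong (λ l _ → I≡I′ l) (subst (Good M E e I m) (I≡I′ m) (proj₁ (max m))) ,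
          λ J good → subst (_⊆I_ M J) (I≡I′ m) (proj₂ (max m) J (good-cong (λ l _ → sym (I≡I′ l)) good))

  InMI : (Car zero → Set ℓ) → Car zero → Set ℓ
  InMI E e = Σ (Box M) λ I → IsMultiInterval M I × _∈B_ M e I × _⊆_ M I E

  -- Were `e` not in the finite set, `maxes` would put it in a multi-interval inside `E`. With
  -- `isol`, this forces the finite part of every canonical decomposition.
  isolated-∈ : ∀ {E D e} → Canonical M E D → E e → ¬ InMI E e → e ∈ proj₂ D
  isolated-∈ {E} {Is , E₀} {e} can Ee ¬mi with em {e ∈ E₀}
  ... | yes e∈ = e∈
  ... | no e∉ = let I , _ , ne , e∈I , I⊆E , _ = find (Canonical.maxes can e Ee e∉)
                in ⊥-elim (¬mi (I , ne , e∈I , I⊆E))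

  -- By `needed`, each box of `D` is maximal around some `e` outside the finite part, which `D` and
  -- `D′` share. So `D′` has a box maximal around the same `e`, and the two coincide.
  canonical-⊆ : ∀ {E D D′} → Canonical M E D → Canonical M E D′ →
    (∀ I → _∈MI_ M I (proj₁ D) → _∈MI_ M I (proj₁ D′)) × (∀ x → x ∈ proj₂ D → x ∈ proj₂ D′)
  canonical-⊆ {E} {D} {D′} can can′ = boxes , E₀⊆F₀ can can′
    where
    E₀⊆F₀ : ∀ {D D′} → Canonical M E D → Canonical M E D′ → ∀ x → x ∈ proj₂ D → x ∈ proj₂ D′
    E₀⊆F₀ can can′ x x∈ =
      isolated-∈ can′ (proj₂ (Canonical.cover can x) (inj₂ x∈)) (Canonical.isol can x x∈)
    boxes : ∀ I → _∈MI_ M I (proj₁ D) → _∈MI_ M I (proj₁ D′)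
    boxes I I∈ =
      let K , K∈ , K≡I = find I∈
          e , Ee , e∉ , maxK = All.lookup (Canonical.needed can) K∈
      in Any.map (λ maxK′ i → trans (maxMI-unique maxK′ maxK i) (K≡I i))
                 (Canonical.maxes can′ e Ee (e∉ ∘ E₀⊆F₀ can′ can e))

  -- Sets invariant over a finite closed `C`; rounding endpoints to `C`.

  module Invariant (E : Car zero → Set ℓ) (C : Pairs) (C-closed : Closed C)
    (invariant : ∀ {x x′} → SameCut C x x′ → E x → E x′) where

    Point : ∀ i → Car (suc i) → Set ℓ
    Point i c = (suc i , c , c) ∈ C

    Lo Hi : ∀ {i} → Ext (Car (suc i)) → Set ℓ
    Lo {i} p = p ≡ -∞ ⊎ Σ (Car (suc i)) λ c → p ≡ fin c × Point i c
    Hi {i} p = p ≡ +∞ ⊎ Σ (Car (suc i)) λ c → p ≡ fin c × Point i c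

    -- The comparison with `p` is weak, so an endpoint already in `C` is its own floor; hence
    -- expansion leaves intervals with ends in `C` unchanged.
    floor : ∀ i p → Σ (Ext (Car (suc i))) λ q → Lo q × ¬ (p <ᵉ q) ×
      (∀ c → Point i c → ¬ (p <ᵉ fin c) → ¬ (q <ᵉ fin c))
    floor i p with Up.supremum i -∞ -∞-least S (ends i C) (λ { (_ , refl , c∈ , _) → ∈-ends c∈ })
      where S = λ e → Σ (Car (suc i)) λ c → e ≡ fin c × Point i c × ¬ (p <ᵉ fin c)
    ... | q , inj₁ refl , ub = q , inj₁ refl , -∞-least p , λ c c∈ c≼p → ub (fin c) (c , refl , c∈ , c≼p)
    ... | q , inj₂ (d , refl , d∈ , d≼p) , ub =
      q , inj₂ (d , refl , d∈) , d≼p , λ c c∈ c≼p → ub (fin c) (c , refl , c∈ , c≼p)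

    ceil : ∀ i p → Σ (Ext (Car (suc i))) λ q → Hi q × ¬ (q <ᵉ p) ×
      (∀ c → Point i c → ¬ (fin c <ᵉ p) → ¬ (fin c <ᵉ q))
    ceil i p with Down.supremum i +∞ +∞-greatest S (ends i C) (λ { (_ , refl , c∈ , _) → ∈-ends c∈ })
      where S = λ e → Σ (Car (suc i)) λ c → e ≡ fin c × Point i c × ¬ (fin c <ᵉ p)
    ... | q , inj₁ refl , lb = q , inj₁ refl , +∞-greatest p , λ c c∈ p≼c → lb (fin c) (c , refl , c∈ , p≼c)
    ... | q , inj₂ (d , refl , d∈ , p≼d) , lb =
      q , inj₂ (d , refl , d∈) , p≼d , λ c c∈ p≼c → lb (fin c) (c , refl , c∈ , p≼c)

    floor-fixed : ∀ {i} p → Lo {i} p → proj₁ (floor i p) ≡ p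
    floor-fixed {i} p lo with floor i p
    floor-fixed {i} p (inj₁ refl) | q , _ , q≼p , _ = Up.≼-antisym i q p q≼p (-∞-least q)
    floor-fixed {i} p (inj₂ (c , refl , c∈)) | q , _ , q≼p , ub =
      Up.≼-antisym i q p q≼p (ub c c∈ (<ᵉ-irrefl p))

    ceil-fixed : ∀ {i} p → Hi {i} p → proj₁ (ceil i p) ≡ p
    ceil-fixed {i} p hi with ceil i p
    ceil-fixed {i} p (inj₁ refl) | q , _ , p≼q , _ = Up.≼-antisym i q p (+∞-greatest q) p≼q
    ceil-fixed {i} p (inj₂ (c , refl , c∈)) | q , _ , p≼q , lb =
      Up.≼-antisym i q p (lb c c∈ (<ᵉ-irrefl p)) p≼q

    floor-< : ∀ {i} y → ¬ Point i y → proj₁ (floor i (fin y)) <ᵉ fin y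
    floor-< {i} y y∉ with floor i (fin y)
    ... | q , lo , q≼y , _ with <ᵉ-compare q (fin y)
    ...   | tri< q<y _ _ = q<y
    ...   | tri> _ _ y<q = ⊥-elim (q≼y y<q)
    floor-< {i} y y∉ | q , inj₂ (_ , refl , c∈) , _ , _ | tri≈ _ refl _ = ⊥-elim (y∉ c∈)

    ceil-> : ∀ {i} y → ¬ Point i y → fin y <ᵉ proj₁ (ceil i (fin y))
    ceil-> {i} y y∉ with ceil i (fin y)
    ... | q , hi , y≼q , _ with <ᵉ-compare (fin y) q
    ...   | tri< y<q _ _ = y<q
    ...   | tri> _ _ q<y = ⊥-elim (y≼q q<y)
    ceil-> {i} y y∉ | q , inj₂ (_ , refl , c∈) , _ , _ | tri≈ _ refl _ = ⊥-elim (y∉ c∈)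

    -- For `y` outside `C` this is the gap of `C` around `y`. For `y` in `C` both ends are `y` and
    -- the interval is empty.
    cellI : ∀ i → Car (suc i) → Interval M i
    cellI i y = proj₁ (floor i (fin y)) , proj₁ (ceil i (fin y))

    cell-agree : ∀ {i y z} → ¬ Point i y → In z (cellI i y) → ∀ {c} → Point i c → Agree i c c y z
    cell-agree {i} {y} {z} y∉ (u<z , z<v) {c} c∈ with floor i (fin y) | ceil i (fin y) | O.compare i c y
    ... | u , _ , _ , ub | _ | tri< c<y _ _ =
      below c<y (Up.≼-<-trans i (fin c) u (fin z) (ub c c∈ (O.asym i c<y)) u<z)
    ... | _ | _ | tri≈ _ refl _ = ⊥-elim (y∉ c∈)
    ... | _ | v , _ , _ , lb | tri> _ _ y<c =
      above y<c (Up.<-≼-trans i (fin z) v (fin c) z<v (lb c c∈ (O.asym i y<c)))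

    expandI : ∀ {i} → Interval M i → Interval M i
    expandI {i} (lo , hi) = proj₁ (floor i lo) , proj₁ (ceil i hi)

    expandI-⊇ : ∀ {i} (J : Interval M i) → _⊆I_ M J (expandI J)
    expandI-⊇ {i} (lo , hi) y (lo<y , y<hi) with floor i lo | ceil i hi
    ... | u , _ , u≼lo , _ | v , _ , hi≼v , _ =
      Up.≼-<-trans i u lo (fin y) u≼lo lo<y , Up.<-≼-trans i (fin y) hi v y<hi hi≼v

    -- Rounding outwards crosses no point of `C`: a point of `C` at or below `lo` is at or below its
    -- floor, and dually for `hi`.
    expandI-point : ∀ {i} (J : Interval M i) {y} → Point i y → In y (expandI J) → In y J
    expandI-point {i} (lo , hi) {y} y∈ (u<y , y<v) with floor i lo | ceil i hi
    ... | u , _ , _ , ub | v , _ , _ , lb = lo<y , y<hi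
      where
      lo<y : lo <ᵉ fin y
      lo<y with Up.≺-or-≽ i lo (fin y)
      ... | inj₁ lo<y = lo<y
      ... | inj₂ y≼lo = ⊥-elim (ub y y∈ y≼lo u<y)
      y<hi : fin y <ᵉ hi
      y<hi with Up.≺-or-≽ i (fin y) hi
      ... | inj₁ y<hi = y<hi
      ... | inj₂ hi≼y = ⊥-elim (lb y y∈ hi≼y y<v)

    -- Expanding an interval J to endpoints in C only adds points of cells that already meet J.
    expandI-meets : ∀ {i} (J : Interval M i) {y} → NonEmptyI M J → ¬ Point i y → In y (expandI J) →
      Σ (Car (suc i)) λ a → Σ (Car (suc i)) λ b → lt i a b ×
        (∀ {z} → lt i a z → lt i z b → In z J × In z (cellI i y))
    expandI-meets {i} (lo , hi) {y} (w , lo<w , w<hi) y∉ (lo⁻<y , y<hi⁺) =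
      -- `p` and `q` bound the overlap of `J` with the gap around `y`.
      let p , p≡ , lo≼p , u≼p = Up.maximum i lo u
          q , q≡ , q≼hi , q≼v = Down.maximum i hi v
          a , b , p<a , a<b , b<q = subinterval p q (p<q p≡ q≡)
          p<z : ∀ {z} → lt i a z → p <ᵉ fin z
          p<z {z} = <ᵉ-trans p (fin a) (fin z) p<a
          z<q : ∀ {z} → lt i z b → fin z <ᵉ q
          z<q {z} z<b = <ᵉ-trans (fin z) (fin b) q z<b b<q
      in a , b , a<b , λ {z} a<z z<b →
           (Up.≼-<-trans i lo p (fin z) lo≼p (p<z a<z) , Up.<-≼-trans i (fin z) q hi (z<q z<b) q≼hi) ,
           (Up.≼-<-trans i u p (fin z) u≼p (p<z a<z) , Up.<-≼-trans i (fin z) q v (z<q z<b) q≼v)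
      where
      u = proj₁ (floor i (fin y))
      v = proj₁ (ceil i (fin y))
      u<y = floor-< y y∉
      y<v = ceil-> y y∉
      -- If `v` were a point `c` of `C` at or below `lo`, the floor of `lo` would be at least `c`,
      -- yet it lies below `y`, which is below `c`.
      lo<v : lo <ᵉ v
      lo<v with ceil i (fin y) | ceil-> {i} y y∉
      ... | _ , inj₁ refl , _ | _ = <ᵉ-trans lo (fin w) +∞ lo<w _
      ... | _ , inj₂ (c , refl , c∈) , _ | y<c with Up.≺-or-≽ i lo (fin c)
      ...   | inj₁ lo<c = lo<c
      ...   | inj₂ c≼lo with floor i lo
      ...     | r , _ , _ , ub = ⊥-elim (ub c c∈ c≼lo (<ᵉ-trans r (fin y) (fin c) lo⁻<y y<c))
      u<hi : u <ᵉ hi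
      u<hi with floor i (fin y) | floor-< {i} y y∉
      ... | _ , inj₁ refl , _ | _ = <ᵉ-trans -∞ (fin w) hi _ w<hi
      ... | _ , inj₂ (c , refl , c∈) , _ | c<y with Up.≺-or-≽ i (fin c) hi
      ...   | inj₁ c<hi = c<hi
      ...   | inj₂ hi≼c with ceil i hi
      ...     | r , _ , _ , lb = ⊥-elim (lb c c∈ hi≼c (<ᵉ-trans (fin c) (fin y) r c<y y<hi⁺))
      p<q : ∀ {p q} → p ≡ lo ⊎ p ≡ u → q ≡ hi ⊎ q ≡ v → p <ᵉ q
      p<q (inj₁ refl) (inj₁ refl) = <ᵉ-trans lo (fin w) hi lo<w w<hi
      p<q (inj₁ refl) (inj₂ refl) = lo<v
      p<q (inj₂ refl) (inj₁ refl) = u<hi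
      p<q (inj₂ refl) (inj₂ refl) = <ᵉ-trans u (fin y) v u<y y<v

    -- Used contrapositively: for `x` outside `C`, every `f i x` lies in a gap of `C`.
    root∈ : ∀ {i x} → Point i (f i x) → (zero , x , x) ∈ C
    root∈ {i} {x} p = subst (λ z → (zero , z , z) ∈ C) (g-image i x _ refl) (g-closed C-closed i p)

    expand : Box M → Box M
    expand K i = expandI (K i)

    -- A point `x` of `C` in the expansion was already in `K`. Otherwise, in every coordinate, the
    -- gap around `f i x` overlaps `K i`; `simult` gives one `z` in all the overlaps, and `z` has
    -- the same cuts as `x`.
    expand-⊆ : ∀ {K} → IsMultiInterval M K → _⊆_ M K E → _⊆_ M (expand K) E
    expand-⊆ {K} ne K⊆E x x∈ with em {(zero , x , x) ∈ C}
    ... | yes x∈C = K⊆E x λ i → expandI-point (K i) (f-closed C-closed i x∈C) (x∈ i)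
    ... | no x∉C =
      let z , z-near = simult (λ i → proj₁ (near i)) (λ i → proj₁ (proj₂ (near i)))
                              (λ i → proj₁ (proj₂ (proj₂ (near i))))
          z∈ : ∀ i → In (f i z) (K i) × In (f i z) (cellI i (f i x))
          z∈ i = proj₂ (proj₂ (proj₂ (near i))) (proj₁ (z-near i)) (proj₂ (z-near i))
      in invariant (λ i c∈ → agree-swap (cell-agree (x∉C ∘ root∈) (proj₂ (z∈ i)) c∈))
                   (K⊆E z (proj₁ ∘ z∈))
      where
      near = λ i → expandI-meets (K i) (ne i) (x∉C ∘ root∈) (x∈ i)

    cell : Car zero → Box M
    cell x i = cellI i (f i x)

    ∈-cell : ∀ {x} → ¬ ((zero , x , x) ∈ C) → _∈B_ M x (cell x)
    ∈-cell x∉ i = floor-< _ (x∉ ∘ root∈) , ceil-> _ (x∉ ∘ root∈)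

    cell-⊆ : ∀ {x} → ¬ ((zero , x , x) ∈ C) → E x → _⊆_ M (cell x) E
    cell-⊆ x∉ Ex z z∈ = invariant (λ i → cell-agree (x∉ ∘ root∈) (z∈ i)) Ex

    EndsIn : ∀ {i} → Interval M i → Set ℓ
    EndsIn (lo , hi) = Lo lo × Hi hi

    expandI-ends : ∀ {i} (J : Interval M i) → EndsIn (expandI J)
    expandI-ends (lo , hi) = proj₁ (proj₂ (floor _ lo)) , proj₁ (proj₂ (ceil _ hi))

    expandI-fixed : ∀ {i} {J : Interval M i} → EndsIn J → expandI J ≡ J
    expandI-fixed {i} {lo , hi} (l , h) = cong₂ _,_ (floor-fixed lo l) (ceil-fixed hi h)

    -- Enlarging a multi-interval in one coordinate.

    record Inside (e : Car zero) (K : Box M) : Set ℓ where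
      field
        ends∈ : ∀ i → EndsIn (K i)
        e∈    : _∈B_ M e K
        ⊆E    : _⊆_ M K E
    open Inside

    expand-inside : ∀ {e} K → _∈B_ M e K → _⊆_ M K E → Inside e (expand K)
    expand-inside K e∈K K⊆E .ends∈ i = expandI-ends (K i)
    expand-inside K e∈K K⊆E .e∈ i = expandI-⊇ (K i) _ (e∈K i)
    expand-inside K e∈K K⊆E .⊆E = expand-⊆ (λ i → _ , e∈K i) K⊆E

    -- `H` equals `K` below `m`, is the hull of `K′ m` and `G m` at `m`, and the intersection of
    -- `K′` and `G` above. A point of `H` has its coordinate `m` in `K′ m` or in `G m`, hence lies
    -- entirely in `K′` or in `G`. Expanding `H` moves its ends to `C` and fixes the coordinates
    -- below `m`.
    enlarge : ∀ {e K K′} m → Inside e K → Inside e K′ → (∀ l → l <ᶠ m → K′ l ≡ K l) →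
      ∀ J → Good M E e K m J → Σ (Box M) λ L → Inside e L × (∀ l → l <ᶠ m → L l ≡ K l) ×
        _⊆I_ M (K′ m) (L m) × _⊆I_ M J (L m)
    enlarge {e} {K} {K′} m κ κ′ K′≡K J (G , G≡K , refl , e∈above , e∈J , G⊆E) =
      expand H , expand-inside H e∈H H⊆E ,
      (λ l l<m → trans (cong expandI (H≡K l l<m)) (expandI-fixed (ends∈ κ l))) ,
      (λ y y∈ → expandI-⊇ (H m) y (proj₁ (proj₂ (H-hull refl)) y y∈)) ,
      (λ y y∈ → expandI-⊇ (H m) y (proj₂ (proj₂ (H-hull refl)) y y∈))
      where
      e∈G = good-∈ (e∈ κ) G≡K e∈above e∈J

      -- Each interval is packaged with its guarantees, so that properties of `H j` do not require
      -- repeating the comparison of `j` with `m`.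
      choice : ∀ j → Σ (Interval M j) λ I → In (f j e) I × (j <ᶠ m → I ≡ K j) ×
        (j ≡ m → (∀ {y} → In y I → In y (K′ j) ⊎ In y (G j)) × _⊆I_ M (K′ j) I × _⊆I_ M (G j) I) ×
        (m <ᶠ j → _⊆I_ M I (K′ j) × _⊆I_ M I (G j))
      choice j with <-cmp j m
      ... | tri< j<m j≢m j≯m =
        K j , e∈ κ j , (λ _ → refl) , (λ j≡m → ⊥-elim (j≢m j≡m)) , (λ j>m → ⊥-elim (j≯m j>m))
      ... | tri≈ j≮m _ j≯m =
        let I , e∈I , I⊆ , ⊆I , ⊆I′ = hull (K′ j) (G j) (e∈ κ′ j) (e∈G j)
        in I , e∈I , (λ j<m → ⊥-elim (j≮m j<m)) , (λ _ → I⊆ , ⊆I , ⊆I′) , (λ j>m → ⊥-elim (j≯m j>m))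
      ... | tri> j≮m j≢m _ =
        let I , ∈I , I⊆ , I⊆′ = meet (K′ j) (G j)
        in I , ∈I (e∈ κ′ j) (e∈G j) , (λ j<m → ⊥-elim (j≮m j<m)) , (λ j≡m → ⊥-elim (j≢m j≡m)) ,
           (λ _ → I⊆ , I⊆′)

      H : Box M
      H j = proj₁ (choice j)
      e∈H : _∈B_ M e H
      e∈H j = proj₁ (proj₂ (choice j))
      H≡K : ∀ j → j <ᶠ m → H j ≡ K j
      H≡K j = proj₁ (proj₂ (proj₂ (choice j)))
      H-hull = λ {j} → proj₁ (proj₂ (proj₂ (proj₂ (choice j))))
      H-meet = λ {j} → proj₂ (proj₂ (proj₂ (proj₂ (choice j))))

      H⊆E : _⊆_ M H E
      H⊆E x x∈ with proj₁ (H-hull refl) (x∈ m)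
      ... | inj₁ x∈K′m = ⊆E κ′ x λ j → case <-cmp j m of λ where
        (tri< j<m _ _) → subst (In (f j x)) (trans (H≡K j j<m) (sym (K′≡K j j<m))) (x∈ j)
        (tri≈ _ refl _) → x∈K′m
        (tri> _ _ m<j) → proj₁ (H-meet m<j) _ (x∈ j)
      ... | inj₂ x∈Gm = G⊆E x λ j → case <-cmp j m of λ where
        (tri< j<m _ _) → subst (In (f j x)) (trans (H≡K j j<m) (sym (G≡K j j<m))) (x∈ j)
        (tri≈ _ refl _) → x∈Gm
        (tri> _ _ m<j) → proj₂ (H-meet m<j) _ (x∈ j)

    -- Goodness is measured against the fixed `K` while `L` accumulates; agreement of `L` with `K`
    -- below `m` keeps `enlarge` applicable.
    enlarge-all : ∀ {e K} m → Inside e K → (Js : List (Interval M m)) →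
      Σ (Box M) λ L → Inside e L × (∀ l → l <ᶠ m → L l ≡ K l) ×
        (∀ J → J ∈ Js → Good M E e K m J → _⊆I_ M J (L m))
    enlarge-all {K = K} m κ [] = K , κ , (λ _ _ → refl) , λ _ ()
    enlarge-all {e} {K} m κ (J ∷ Js) with enlarge-all m κ Js | em {Good M E e K m J}
    ... | L , λ′ , L≡K , bound | no ¬good = L , λ′ , L≡K , λ where
      _ (here refl) good → ⊥-elim (¬good good)
      J′ (there J′∈) → bound J′ J′∈
    ... | L , λ′ , L≡K , bound | yes good =
      let L′ , λ″ , L′≡K , L⊆L′ , J⊆L′ = enlarge m κ λ′ L≡K J good
      in L′ , λ″ , L′≡K , λ where
           _ (here refl) _ → J⊆L′
           J′ (there J′∈) good′ y y∈ → L⊆L′ y (bound J′ J′∈ good′ y y∈)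

    -- Maximal multi-intervals from finitely many candidates.

    intervals : ∀ i → List (Interval M i)
    intervals i = cartesianProduct (-∞ ∷ ends i C) (+∞ ∷ ends i C)

    ∈-intervals : ∀ {i} {J : Interval M i} → EndsIn J → J ∈ intervals i
    ∈-intervals {i} {lo , hi} (l , h) = ∈-cartesianProduct⁺ (lo∈ l) (hi∈ h)
      where
      lo∈ : Lo lo → lo ∈ -∞ ∷ ends i C
      lo∈ (inj₁ refl) = here refl
      lo∈ (inj₂ (_ , refl , c∈)) = there (∈-ends c∈)
      hi∈ : Hi hi → hi ∈ +∞ ∷ ends i C
      hi∈ (inj₁ refl) = here refl
      hi∈ (inj₂ (_ , refl , c∈)) = there (∈-ends c∈)

    Maximal : Car zero → Box M → Fin n → Set ℓ
    Maximal e K m = ∀ J → Good M E e K m J → _⊆I_ M J (K m)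

    -- Reduces maximality to a finite test: a good `J` lies in its expansion, which is again good
    -- and occurs in `intervals m`.
    good-expand : ∀ {e K m J} → Inside e K → Good M E e K m J → Good M E e K m (expandI J)
    good-expand {e} {K} {m} {J} κ (G , G≡K , refl , e∈above , e∈J , G⊆E) =
      expand G ,
      (λ l l<m → trans (cong expandI (G≡K l l<m)) (expandI-fixed (ends∈ κ l))) , refl ,
      (λ j m<j → expandI-⊇ (G j) _ (e∈above j m<j)) , expandI-⊇ (G m) _ e∈J ,
      expand-⊆ (λ j → _ , e∈G j) G⊆E
      where
      e∈G = good-∈ (e∈ κ) G≡K e∈above e∈J

    maximise : ∀ {e K} m → Inside e K →
      Σ (Box M) λ L → Inside e L × (∀ l → l <ᶠ m → L l ≡ K l) × Maximal e L m
    maximise m κ =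
      let L , λ′ , L≡K , bound = enlarge-all m κ (intervals m)
      in L , λ′ , L≡K , λ J good y y∈ →
           bound (expandI J) (∈-intervals (expandI-ends J))
                 (good-expand κ (good-cong L≡K good)) y (expandI-⊇ J y y∈)

    -- Coordinates are treated in increasing order: step `m` may alter those above `m`, but
    -- maximality at `l` depends only on coordinates up to `l`, so what was achieved earlier
    -- survives.
    maximise-below : ∀ {e K} k → k ≤ n → Inside e K →
      Σ (Box M) λ L → Inside e L × (∀ m → toℕ m < k → Maximal e L m)
    maximise-below ℕ.zero _ κ = _ , κ , λ _ ()
    maximise-below {e} (ℕ.suc k) k<n κ =
      let K , κ′ , max = maximise-below k (<⇒≤ k<n) κ
          m = fromℕ< k<n
          m≡k = toℕ-fromℕ< k<n
          L , λ′ , L≡K , maxL = maximise m κ′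
      in L , λ′ , λ l l<1+k → case m≤n⇒m<n∨m≡n (≤-pred l<1+k) of λ where
           (inj₁ l<k) J good →
             let l<m = subst (toℕ l <_) (sym m≡k) l<k
             in subst (_⊆I_ M J) (sym (L≡K l l<m))
                  (max l l<k J (good-cong (λ j j<l → L≡K j (<-trans j<l l<m)) good))
           (inj₂ l≡k) → subst (Maximal e L) (sym (toℕ-injective (trans l≡k (sym m≡k)))) maxL

    maxMI-exists : ∀ {e} → InMI E e → Σ (Box M) λ L → (∀ i → EndsIn (L i)) × MaxMI M E e L
    maxMI-exists (I , _ , e∈I , I⊆E) =
      let L , λ′ , max = maximise-below n ≤-refl (expand-inside I e∈I I⊆E)
      in L , ends∈ λ′ , (λ i → _ , e∈ λ′ i) , e∈ λ′ , ⊆E λ′ ,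
         λ m → (L , (λ _ _ → refl) , refl , (λ j _ → e∈ λ′ j) , e∈ λ′ m , ⊆E λ′) , max m (toℕ<n m)

    -- Assembling the canonical decomposition.

    isolated-closed : ∀ {e} → E e → ¬ InMI E e → (zero , e , e) ∈ C
    isolated-closed {e} Ee ¬mi with em {(zero , e , e) ∈ C}
    ... | yes e∈C = e∈C
    -- Outside `C` the cell of `e` is itself a multi-interval in `E`, so isolated points are among
    -- the finitely many points of `C`.
    ... | no e∉C = ⊥-elim (¬mi (cell e , (λ i → _ , ∈-cell e∉C i) , ∈-cell e∉C , cell-⊆ e∉C Ee))

    roots : Pairs → List (Car zero)
    roots [] = []
    roots ((zero , x , _) ∷ P) = x ∷ roots P
    roots ((suc _ , _) ∷ P) = roots P

    ∈-roots : ∀ {P x x′} → (zero , x , x′) ∈ P → x ∈ roots P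
    ∈-roots (here refl) = here refl
    ∈-roots {(zero , _) ∷ _} (there p) = there (∈-roots p)
    ∈-roots {(suc _ , _) ∷ _} (there p) = ∈-roots p

    Isolated : Car zero → Set ℓ
    Isolated e = E e × ¬ InMI E e

    isolated : List (Car zero)
    isolated = filter (λ e → em {Isolated e}) (roots C)

    ∈-isolated⁻ : ∀ {e} → e ∈ isolated → Isolated e
    ∈-isolated⁻ e∈ = proj₂ (∈-filter⁻ (λ e → em {Isolated e}) {xs = roots C} e∈)

    ∉-isolated : ∀ {e} → E e → e ∉ isolated → InMI E e
    ∉-isolated {e} Ee e∉ with em {InMI E e}
    ... | yes mi = mi
    ... | no ¬mi = ⊥-elim (e∉ (∈-filter⁺ (λ e → em {Isolated e})
                                 (∈-roots (isolated-closed Ee ¬mi)) (Ee , ¬mi)))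

    -- The endpoint condition is kept with the witness, so that the location of the extremities can
    -- be read off the finished list.
    Needed : Box M → Set ℓ
    Needed I = (∀ i → EndsIn (I i)) × Σ (Car zero) λ e → E e × e ∉ isolated × MaxMI M E e I

    maximal-boxes : List (Box M)
    maximal-boxes = filter (λ I → em {Needed I}) (choices intervals)

    maximal-boxes-needed : All Needed maximal-boxes
    maximal-boxes-needed =
      All.tabulate λ I∈ → proj₂ (∈-filter⁻ (λ I → em {Needed I}) {xs = choices intervals} I∈)

    maximal-boxes-complete : ∀ {e} → E e → e ∉ isolated → Any (MaxMI M E e) maximal-boxes
    maximal-boxes-complete {e} Ee e∉ =
      let L , L-ends , maxL = maxMI-exists (∉-isolated Ee e∉)
          K , K∈ , K≡L = find (∈-choices intervals L (∈-intervals ∘ L-ends))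
          -- `choices` contains `L` only up to pointwise equality, so maximality is carried over to
          -- the listed `K`.
          maxK = maxMI-resp (sym ∘ K≡L) maxL
      in lose (∈-filter⁺ (λ I → em {Needed I}) K∈
                 ((λ i → subst EndsIn (sym (K≡L i)) (L-ends i)) , e , Ee , e∉ , maxK))
              maxK

    decomposition : Decomp M
    decomposition = maximal-boxes , isolated

    decomposition-canonical : Canonical M E decomposition
    decomposition-canonical = record
      { multi  = All.map (λ (_ , _ , _ , _ , ne , _) → ne) maximal-boxes-needed
      ; E₀⊆E   = All.tabulate (proj₁ ∘ ∈-isolated⁻)
      ; cover  = λ x → covered x , [ contained x , proj₁ ∘ ∈-isolated⁻ ]
      ; isol   = λ e e∈ → proj₂ (∈-isolated⁻ e∈)
      ; maxes  = λ e → maximal-boxes-complete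
      ; needed = All.map proj₂ maximal-boxes-needed
      }
      where
      covered : ∀ x → E x → Any (_∈B_ M x) maximal-boxes ⊎ x ∈ isolated
      covered x Ex with em {x ∈ isolated}
      ... | yes x∈ = inj₂ x∈
      ... | no x∉ = inj₁ (Any.map (λ (_ , x∈I , _) → x∈I) (maximal-boxes-complete Ex x∉))
      contained : ∀ x → Any (_∈B_ M x) maximal-boxes → E x
      contained x x∈ =
        let I , I∈ , x∈I = find x∈
            _ , _ , _ , _ , _ , _ , I⊆E , _ = All.lookup maximal-boxes-needed I∈
        in I⊆E x x∈I

theorem3p8 : {ℓ : Level} → ExcludedMiddle ℓ →
    (n : ℕ) → 1 ≤ n → (M : Structure n ℓ) → IsVO M →
    (A : Params M) → (E : Structure.Car M zero → Set ℓ) → Definable M A E →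
    Σ (Decomp M) λ D →
    Canonical M E D ×
    ((D′ : Decomp M) → Canonical M E D′ → SameDecomp M D D′) ×
    ExtremitiesIn M A D
theorem3p8 em n@(ℕ.suc _) (s≤s _) M vo A E def =
  decomposition , decomposition-canonical ,
  (λ D′ can′ →
     let boxes , points = canonical-⊆ decomposition-canonical can′
         boxes′ , points′ = canonical-⊆ can′ decomposition-canonical
     in (λ I → boxes I , boxes′ I) , (λ x → points x , points′ x)) ,
  All.map (λ (ends , _) i → lo-gen (proj₁ (ends i)) , hi-gen (proj₂ (ends i))) maximal-boxes-needed
  where
  -- As `n` is at least 1, `zero` serves as the coordinate through which equality in sort `zero` is
  -- read.
  open Model em zero M vo
  open Invariant E (closure A) (closure-closed A) (definable-invariant def)
  lo-gen : ∀ {i p} → Lo {i} p → ExtInGen M A i p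
  lo-gen (inj₁ refl) = _
  lo-gen (inj₂ (_ , refl , c∈)) = proj₂ (closure-diagonal A base c∈)
  hi-gen : ∀ {i p} → Hi {i} p → ExtInGen M A i p
  hi-gen (inj₁ refl) = _
  hi-gen (inj₂ (_ , refl , c∈)) = proj₂ (closure-diagonal A base c∈)
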